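{- Leafage is not bounded by any function of $f^*$ when $f^*\ge 3$; that is, there is no function $g:\mathbb{N}\to\mathbb{N}$ such that $l(D)\le g(f^*(D))$ for every digraph $D$ with $f^*(D)\ge 3$. In particular, let $E_n$ be the $n$-vertex digraph with adjacency matrix $$A(E_n)=\begin{pmatrix} I & Y\\ Y^T & 0\end{pmatrix},$$ where $I$ is the $(n-1)\times(n-1)$ identity matrix and $Y$ is the column vector of $n-1$ ones. If $n\ge 3$, then $l(E_n)=n$, but $f^*(E_n)=f(E_n)=3$.
   Context: A digraph $D$ is finite with nonempty vertex set $V(D)$, and is identified with a relation $D\subseteq V(D)\times V(D)$ (its set of edges; loops are allowed, no multiple edges). Its adjacency matrix $A(D)$ has entry $1$ in position $(u,v)$ if $uv$ is an edge and $0$ otherwise. $\overline{D}=(V(D)\times V(D))\setminus D$ is its complement. Trees are finite; a leaf is a vertex of degree 1. Subtrees are nonempty connected subgraphs. A subtree representation of $D$ in a host tree $T$ assigns to each vertex $v$ an ordered pair $(S_v,T_v)$ of subtrees of $T$ such that $uv$ is an edge of $D$ if and only if $S_u$ and $T_v$ have a common vertex (for all $u,v\in V(D)$, including $u=v$). The leafage $l(D)$ is the minimum number of leaves of a host tree in which $D$ has a subtree representation. A digraph is a Ferrers digraph if its successor sets $\{u: vu\in E\}$, over all vertices $v$, are linearly ordered by inclusion; equivalently, its adjacency matrix has no $2\times 2$ permutation submatrix (two rows and two columns, not necessarily consecutive). The Ferrers dimension $f(D)$ is the minimum number of Ferrers digraphs on $V(D)$ whose intersection is $D$, equivalently the minimum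 number of Ferrers digraphs on $V(D)$ whose union is $\overline{D}$. $f^*(D)$ is the minimum number of pairwise disjoint Ferrers digraphs on $V(D)$ (as edge sets) whose union is $\overline{D}$. -}

module Defs where

open import Data.Bool.Base using (Bool; true; false; T)
open import Data.Fin.Base using (Fin; zero; suc; toℕ; inject₁; fromℕ)
import Data.Fin.Properties as Fin
open import Data.Fin.Subset using (Subset; _∈_; _∩_; ∣_∣; Nonempty)
open import Data.Nat.Base using (ℕ; suc; _+_; _≤_; NonZero)
open import Data.Nat.Properties using (_≟_)
open import Data.Product.Base using (_×_; Σ-syntax; ∃-syntax; uncurry)
open import Data.Vec.Base using (tabulate)
open import Function.Bundles using (_⇔_)
open import Function.Definitions using (Injective)
open import Level using (0ℓ)
open import Relation.Binary.Construct.Closure.ReflexiveTransitive using (Star)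
open import Relation.Binary.Core using (Rel)
open import Relation.Binary.Definitions using (Symmetric; Irreflexive; Total)
open import Relation.Binary.PropositionalEquality.Core using (_≡_; _≢_)
open import Relation.Nullary using (¬_; does)
open import Relation.Unary using (Pred; ∁; ⋃; ⋂; _⊆_; _≐_; _⊥_)

IsMinimum : Pred ℕ 0ℓ → Pred ℕ 0ℓ
IsMinimum P k = P k × (∀ j → P j → k ≤ j)

-- A digraph with vertex set Fin n is given by its 0/1 adjacency matrix.
Digraph : ℕ → Set
Digraph n = Fin n → Fin n → Bool

Edge : ∀ {n} → Digraph n → Rel (Fin n) 0ℓ
Edge D u v = T (D u v)

EdgeSet : ∀ {n} → Digraph n → Pred (Fin n × Fin n) 0ℓ
EdgeSet D = uncurry (Edge D)

-- Edge D v is the successor set of v.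
Ferrers : ∀ {n} → Digraph n → Set
Ferrers D = Total (λ u v → Edge D u ⊆ Edge D v)

IsIntersectionOfFerrers : ∀ {n} → Digraph n → ℕ → Set
IsIntersectionOfFerrers {n} D k =
  Σ[ F ∈ (Fin k → Digraph n) ]
    (∀ i → Ferrers (F i)) ×
    (⋂[ i ∶ Fin k ] EdgeSet (F i)) ≐ EdgeSet D

IsFerrersDimension : ∀ {n} → Digraph n → ℕ → Set
IsFerrersDimension D = IsMinimum (IsIntersectionOfFerrers D)

ComplementIsDisjointUnionOfFerrers : ∀ {n} → Digraph n → ℕ → Set
ComplementIsDisjointUnionOfFerrers {n} D k =
  Σ[ F ∈ (Fin k → Digraph n) ]
    (∀ i → Ferrers (F i)) ×
    (∀ i j → i ≢ j → EdgeSet (F i) ⊥ EdgeSet (F j)) ×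
    (⋃[ i ∶ Fin k ] EdgeSet (F i)) ≐ ∁ (EdgeSet D)

IsDisjointFerrersNumber : ∀ {n} → Digraph n → ℕ → Set
IsDisjointFerrersNumber D = IsMinimum (ComplementIsDisjointUnionOfFerrers D)

record Graph (n : ℕ) : Set where
  field
    adjacent : Fin n → Fin n → Bool

  Adj : Rel (Fin n) 0ℓ
  Adj u v = T (adjacent u v)

  field
    symmetric   : Symmetric Adj
    irreflexive : Irreflexive _≡_ Adj

  degree : Fin n → ℕ
  degree v = ∣ tabulate (adjacent v) ∣

  leafCount : ℕ
  leafCount = ∣ tabulate (λ v → does (degree v ≟ 1)) ∣

  Connected : Set
  Connected = ∀ u v → Star Adj u v

  -- A cycle of length 3 + k.
  record Cycle (k : ℕ) : Set where
    field
      vertex    : Fin (3 + k) → Fin n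
      injective : Injective _≡_ _≡_ vertex
      step      : ∀ (i : Fin (2 + k)) → Adj (vertex (inject₁ i)) (vertex (suc i))
      close     : Adj (vertex (fromℕ (2 + k))) (vertex zero)

  Acyclic : Set
  Acyclic = ∀ k → ¬ Cycle k

record Tree (n : ℕ) : Set where
  field
    graph     : Graph n
    nonempty  : NonZero n
    connected : Graph.Connected graph
    acyclic   : Graph.Acyclic graph

  open Graph graph public

record Subtree {n : ℕ} (H : Tree n) : Set where
  open Tree H using (Adj)
  field
    vertices : Subset n
    joined   : Fin n → Fin n → Bool

  Joined : Rel (Fin n) 0ℓ
  Joined u v = T (joined u v)

  field
    symmetric : Symmetric Joined
    subgraph  : ∀ {u v} → Joined u v → Adj u v × u ∈ vertices × v ∈ vertices
    nonempty  : Nonempty vertices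
    connected : ∀ {u v} → u ∈ vertices → v ∈ vertices → Star Joined u v

record SubtreeRepresentation {n m : ℕ} (D : Digraph n) (H : Tree m) : Set where
  field
    source target : Fin n → Subtree H
    represents    : ∀ u v →
      Edge D u v ⇔
      Nonempty (Subtree.vertices (source u) ∩ Subtree.vertices (target v))

RepresentableWithLeaves : ∀ {n} → Digraph n → ℕ → Set
RepresentableWithLeaves D k =
  ∃[ m ] Σ[ H ∈ Tree m ] SubtreeRepresentation D H × Tree.leafCount H ≡ k

IsLeafage : ∀ {n} → Digraph n → ℕ → Set
IsLeafage D = IsMinimum (RepresentableWithLeaves D)

isLast : ∀ {n} → Fin n → Bool
isLast {n} i = does (suc (toℕ i) ≟ n)

-- The arguments of block say whether the row and the column are the last one.
E : ∀ n → Digraph n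
E n i j = block (isLast i) (isLast j)
  where
  block : Bool → Bool → Bool
  block false false = does (i Fin.≟ j)
  block false true  = true
  block true  false = true
  block true  true  = false

{-# OPTIONS --safe #-}
module Submission where

-- Leafage: an edge uv on the way from S_n to T_n is covered by S_i ∪ T_i for every
-- i < n.  Because S_i misses T_j for i ≠ j, and S_i meets T_i, either all T_i contain
-- u and v and no S_i does, or the other way round.  In the first case walk from v
-- inside T_i until S_i is entered; the n - 1 entering arcs, together with the arc from
-- v to u, point into pairwise disjoint parts of the tree, so there are n leaves.  The
-- star with n leaves is optimal: S_u is the leaf u, and T_v is the centre together
-- with the predecessors of v.
--
-- Ferrers numbers: the complement of E_n splits into the strictly upper triangle and
-- the strictly lower triangle of the identity block, and the corner.  The zeros
-- (1,2), (2,1) and (n,n) pairwise lie in a 2 × 2 permutation submatrix, so three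
-- Ferrers digraphs are needed even without disjointness.

open import Defs
open import Data.Bool.Base using (Bool; true; false; T; not; _∧_)
open import Data.Bool.Properties using (T?; T-≡; T-∧)
open import Data.Empty using (⊥; ⊥-elim)
open import Data.Fin.Base using (Fin; zero; suc; toℕ; inject₁; fromℕ)
import Data.Fin.Properties as Fin
open import Data.Fin.Relation.Unary.Top using (view; ‵fromℕ; ‵inject₁)
open import Data.Fin.Subset using (Subset; _∈_; _-_; ∣_∣; ⁅_⁆; Nonempty; inside)
open import Data.Fin.Subset.Properties
open import Data.Nat.Base using (ℕ; zero; suc; _+_; _≤_; _<_; z≤n; s≤s; NonZero)
import Data.Nat.Properties as ℕ
open import Data.Product.Base using (_×_; _,_; Σ-syntax; ∃-syntax; proj₁; proj₂)
import Data.Sum.Base as Sum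
open import Data.Sum.Base using (_⊎_; inj₁; inj₂; [_,_]′)
open import Data.Unit.Base using (tt)
open import Data.Vec.Base using (_∷_; here; there; tabulate)
open import Data.Vec.Properties using (lookup∘tabulate; lookup⇒[]=; []=⇒lookup)
open import Function.Base using (_∘_; id)
open import Function.Bundles using (_⇔_; mk⇔; Equivalence)
open import Function.Definitions using (Injective)
open import Level using (0ℓ)
open import Relation.Binary.Construct.Closure.ReflexiveTransitive using (Star; ε; _◅_; _◅◅_)
open import Relation.Binary.Core using (Rel)
open import Relation.Binary.Definitions using (Total; tri<; tri≈; tri>)
open import Relation.Binary.PropositionalEquality using (_≡_; _≢_; refl; sym; trans; cong; subst)
open import Relation.Nullary using (¬_; Dec; yes; no; does; contradiction)
open import Relation.Nullary.Decidable using (¬?; _×-dec_; dec-true; dec-false; decidable-stable)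
open import Relation.Unary using (Pred; Decidable; U; ∁; _⊆_)
  renaming (_∩_ to _∩ᵖ_; _⊥_ to _⊥ᵖ_)

private
  variable
    m n : ℕ

-- Boolean tests, subsets and counting by injections.

does⁺ : ∀ {A : Set} (a? : Dec A) → A → T (does a?)
does⁺ a? a = Equivalence.from T-≡ (dec-true a? a)

does⁻ : ∀ {A : Set} (a? : Dec A) → T (does a?) → A
does⁻ (yes a) _ = a

T-not⁺ : ∀ {b} → ¬ T b → T (not b)
T-not⁺ {true}  ¬b = ¬b tt
T-not⁺ {false} ¬b = tt

T-not⁻ : ∀ {b} → T (not b) → ¬ T b
T-not⁻ {false} _ ()

T⇒∈ : ∀ {f : Fin n → Bool} {x} → T (f x) → x ∈ tabulate f
T⇒∈ {f = f} {x} t =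
  lookup⇒[]= x _ (trans (lookup∘tabulate f x) (Equivalence.to T-≡ t))

∈⇒T : ∀ {f : Fin n → Bool} {x} → x ∈ tabulate f → T (f x)
∈⇒T {f = f} {x} x∈ =
  Equivalence.from T-≡ (trans (sym (lookup∘tabulate f x)) ([]=⇒lookup x∈))

distinct⇒injective : ∀ {A : Set} {f : Fin n → A} →
                     (∀ i j → i ≢ j → f i ≢ f j) → Injective _≡_ _≡_ f
distinct⇒injective distinct {i} {j} eq with i Fin.≟ j
... | yes i≡j = i≡j
... | no  i≢j = contradiction eq (distinct i j i≢j)

injective⇒≤∣p∣ : ∀ {k} {f : Fin k → Fin n} (p : Subset n) →
                 Injective _≡_ _≡_ f → (∀ i → f i ∈ p) → k ≤ ∣ p ∣
injective⇒≤∣p∣ {k = zero}  p inj f∈ = z≤n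
injective⇒≤∣p∣ {k = suc k} {f} p inj f∈ = ℕ.≤-trans
  (s≤s (injective⇒≤∣p∣ (p - f zero) (Fin.suc-injective ∘ inj)
    λ i → x∈p∧x≢y⇒x∈p-y (f∈ (suc i)) (λ eq → contradiction (inj eq) λ ())))
  (x∈p⇒∣p-x∣<∣p∣ (f∈ zero))

-- Walks, paths and separation in a tree.

module InTree (H : Tree n) where
  open Tree H

  data Walk (P : Pred (Fin n) 0ℓ) : Fin n → Fin n → Set where
    stop : ∀ {u} → P u → Walk P u u
    move : ∀ {u v w} → P u → Adj u v → Walk P v w → Walk P u w

  private
    variable
      P Q   : Pred (Fin n) 0ℓ
      u v w : Fin n

  start : Walk P u v → P u
  start (stop p)     = p
  start (move p _ _) = p

  end : Walk P u v → P v
  end (stop p)     = p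
  end (move _ _ ω) = end ω

  map : P ⊆ Q → Walk P u v → Walk Q u v
  map f (stop p)     = stop (f p)
  map f (move p a ω) = move (f p) a (map f ω)

  infixr 5 _++_
  _++_ : Walk P u v → Walk P v w → Walk P u w
  stop _     ++ ω′ = ω′
  move p a ω ++ ω′ = move p a (ω ++ ω′)

  snoc : Walk P u v → Adj v w → P w → Walk P u w
  snoc ω a p = ω ++ move (end ω) a (stop p)

  reverse : Walk P u v → Walk P v u
  reverse (stop p)     = stop p
  reverse (move p a ω) = snoc (reverse ω) (symmetric a) p

  fromStar : Star Adj u v → Walk U u v
  fromStar ε       = stop tt
  fromStar (a ◅ ω) = move tt a (fromStar ω)

  -- Since `approach` stays outside `Q`, its reverse avoids `after` and every other vertex of `Q`.
  record Crossing (P Q : Pred (Fin n) 0ℓ) (u : Fin n) : Set where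
    field
      {before after} : Fin n
      approach       : Walk (P ∩ᵖ ∁ Q) u before
      crosses        : Adj before after
      after∈P        : P after
      after∈Q        : Q after

  firstCrossing : Decidable Q → Walk P u v → ¬ Q u → Q v → Crossing P Q u
  firstCrossing Q? (stop _) ¬q q = contradiction q ¬q
  firstCrossing Q? (move {v = v} p a ω) ¬q q with Q? v
  ... | yes qv = record
    { approach = stop (p , ¬q) ; crosses = a ; after∈P = start ω ; after∈Q = qv }
  ... | no ¬qv = record
    { approach = move (p , ¬q) a approach ; crosses = crosses
    ; after∈P = after∈P ; after∈Q = after∈Q }
    where open Crossing (firstCrossing Q? ω ¬qv q)

  avoid-or-reach : ∀ z → Walk P u v → Walk (_≢ z) u v ⊎ Walk P u z
  avoid-or-reach {u = u} z ω with u Fin.≟ z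
  avoid-or-reach z ω            | yes refl = inj₂ (stop (start ω))
  avoid-or-reach z (stop _)     | no u≢z   = inj₁ (stop u≢z)
  avoid-or-reach z (move p a ω) | no u≢z   with avoid-or-reach z ω
  ... | inj₁ ω′ = inj₁ (move u≢z a ω′)
  ... | inj₂ ω′ = inj₂ (move p a ω′)

  IsPath : ∀ {l} → (Fin (suc l) → Fin n) → Set
  IsPath {l} φ = Injective _≡_ _≡_ φ × (∀ (i : Fin l) → Adj (φ (inject₁ i)) (φ (suc i)))

  private
    cons : ∀ {l} → Fin n → (Fin l → Fin n) → Fin (suc l) → Fin n
    cons u φ zero    = u
    cons u φ (suc i) = φ i

  singleton-isPath : ∀ u → IsPath {0} (λ _ → u)
  singleton-isPath u = (λ { {zero} {zero} _ → refl }) , λ ()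

  cons-isPath : ∀ {l} {φ : Fin (suc l) → Fin n} →
                Adj u (φ zero) → (∀ i → φ i ≢ u) → IsPath φ → IsPath (cons u φ)
  cons-isPath {u = u} {φ = φ} a u∉φ (inj , adj) = inj′ , adj′
    where
    inj′ : Injective _≡_ _≡_ (cons u φ)
    inj′ {zero}  {zero}  _  = refl
    inj′ {zero}  {suc j} eq = contradiction (sym eq) (u∉φ j)
    inj′ {suc i} {zero}  eq = contradiction eq (u∉φ i)
    inj′ {suc i} {suc j} eq = cong suc (inj eq)
    adj′ : ∀ i → Adj (cons u φ (inject₁ i)) (φ i)
    adj′ zero    = a
    adj′ (suc i) = adj i

  tail-isPath : ∀ {l} {φ : Fin (suc (suc l)) → Fin n} → IsPath φ → IsPath (φ ∘ suc)
  tail-isPath (inj , adj) = Fin.suc-injective ∘ inj , adj ∘ suc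

  prefix : ∀ {l} {φ : Fin (suc l) → Fin n} → IsPath φ → (∀ i → P (φ i)) →
           ∀ i → Walk P (φ zero) (φ i)
  prefix             path all zero    = stop (all zero)
  prefix {l = suc l} path all (suc i) =
    move (all zero) (proj₂ path zero) (prefix (tail-isPath path) (all ∘ suc) i)

  record Path (P : Pred (Fin n) 0ℓ) (u v : Fin n) : Set where
    field
      {len}   : ℕ
      vertex  : Fin (suc len) → Fin n
      isPath  : IsPath vertex
      allP    : ∀ i → P (vertex i)
      starts  : vertex zero ≡ u
      ends    : vertex (fromℕ len) ≡ v

  dropTo : ∀ {l} {φ : Fin (suc l) → Fin n} → IsPath φ → (∀ i → P (φ i)) →
           ∀ i → Path P (φ i) (φ (fromℕ l))
  dropTo             path all zero    =
    record { vertex = _ ; isPath = path ; allP = all ; starts = refl ; ends = refl }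
  dropTo {l = suc l} path all (suc i) = dropTo (tail-isPath path) (all ∘ suc) i

  -- Recursion on the walk: if the new vertex already lies on the path built so far, the path is cut
  -- at that occurrence, and otherwise it is prepended.
  eraseLoops : Walk P u v → Path P u v
  eraseLoops {u = u} (stop p) = record
    { len = 0 ; vertex = λ _ → u
    ; isPath = singleton-isPath u
    ; allP = λ _ → p ; starts = refl ; ends = refl }
  eraseLoops {P = P} {u} {v} (move p a ω) with eraseLoops ω
  ... | record { vertex = φ ; isPath = path ; allP = all ; starts = refl ; ends = refl }
    with Fin.any? (λ i → φ i Fin.≟ u)
  ... | yes (i , refl) = dropTo path all i
  ... | no  u∉φ = record
    { vertex = cons u φ
    ; isPath = cons-isPath a (λ i eq → u∉φ (i , eq)) path
    ; allP = λ { zero → p ; (suc i) → all i }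
    ; starts = refl ; ends = refl }

  -- A walk from `u` to `w` off `v` shortens to a path off `v`, which `v` closes to a cycle; `u ≢ w`
  -- gives the path positive length.
  neighbours-separated : Adj v u → Adj v w → u ≢ w → ¬ Walk (_≢ v) u w
  neighbours-separated {v = v} v~u v~w u≢w ω with eraseLoops ω
  ... | record { len = zero  ; starts = refl ; ends = refl } = u≢w refl
  ... | record { len = suc k ; vertex = φ ; isPath = path ; allP = all
               ; starts = refl ; ends = refl } = acyclic k record
    { vertex = cons v φ ; injective = proj₁ path′ ; step = proj₂ path′
    ; close = symmetric v~w }
    where path′ = cons-isPath v~u all path

  -- Follow the second walk back from `x` until it first hits `v`. The vertex before is a neighbour
  -- of `v` other than `u`, and it is joined to `u` through `x` without using `v`.
  edge-separates : ∀ {x} → Adj u v → Walk (_≢ v) u x → ¬ Walk (_≢ u) v x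
  edge-separates {v = v} u~v ω ω′ =
    neighbours-separated
      (subst (λ r → Adj r before) after∈Q (symmetric crosses)) (symmetric u~v)
      (proj₁ (end approach))
      (reverse (map proj₂ approach) ++ reverse ω)
    where open Crossing (firstCrossing (Fin._≟ v) (reverse ω′) (end ω) refl)

  -- Leaves beyond the edges of a tree.

  otherNeighbour : Adj u v → degree u ≢ 1 → ∃[ w ] Adj u w × w ≢ v
  otherNeighbour {u} {v} u~v deg≢1
    with Fin.any? (λ w → T? (adjacent u w) ×-dec ¬? (w Fin.≟ v))
  ... | yes found = found
  ... | no  none  = contradiction (ℕ.≤-antisym deg≤1 1≤deg) deg≢1
    where
    only-v : ∀ {w} → w ∈ tabulate (adjacent u) → w ∈ ⁅ v ⁆
    only-v {w} w∈ with w Fin.≟ v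
    ... | yes refl = x∈⁅x⁆ v
    ... | no  w≢v  = contradiction (w , ∈⇒T w∈ , w≢v) none
    deg≤1 : degree u ≤ 1
    deg≤1 = subst (degree u ≤_) (∣⁅x⁆∣≡1 v) (p⊆q⇒∣p∣≤∣q∣ only-v)
    1≤deg : 1 ≤ degree u
    1≤deg = ℕ.≤-trans (s≤s z≤n) (x∈p⇒∣p-x∣<∣p∣ (T⇒∈ {f = adjacent u} u~v))

  leafBeyond : Adj u v → ∃[ ℓ ] degree ℓ ≡ 1 × Walk (_≢ u) v ℓ
  -- The path starts as `v`, `u` and grows until its end is a leaf. A path of `2 + l` vertices needs
  -- `2 + l ≤ n`, so `n ≤ l + fuel` keeps the fuel from running out.
  leafBeyond {u} {v} u~v = extend n ℕ.≤-refl
    (cons-isPath (symmetric u~v) (λ _ → u≢v) (singleton-isPath u))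
    (suc zero) refl (stop (u≢v ∘ sym))
    where
    u≢v : u ≢ v
    u≢v u≡v = irreflexive u≡v u~v
    -- φ runs backwards: it starts at the current end of the path and reaches u.
    extend : ∀ {l} fuel {φ : Fin (2 + l) → Fin n} → n ≤ l + fuel → IsPath φ →
             ∀ j → φ j ≡ u → Walk (_≢ u) v (φ zero) →
             ∃[ ℓ ] degree ℓ ≡ 1 × Walk (_≢ u) v ℓ
    extend {l} fuel {φ} n≤ path@(inj , adj) j φj≡u ω with degree (φ zero) ℕ.≟ 1
    ... | yes leaf = φ zero , leaf , ω
    ... | no ¬leaf with otherNeighbour (adj zero) ¬leaf
    ... | w , c~w , w≢p = continue fuel n≤
      where
      w∉φ : ∀ i → φ i ≢ w
      w∉φ zero    eq   = irreflexive eq c~w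
      -- Otherwise the rest of the path would join two neighbours of its end `φ zero` without using
      -- that end.
      w∉φ (suc i) refl = neighbours-separated (adj zero) c~w (w≢p ∘ sym)
        (prefix (tail-isPath path) (λ _ eq → contradiction (inj eq) λ ()) i)
      continue : ∀ fuel → n ≤ l + fuel → ∃[ ℓ ] degree ℓ ≡ 1 × Walk (_≢ u) v ℓ
      continue zero       n≤ = contradiction
        (ℕ.≤-trans (Fin.injective⇒≤ inj) (subst (n ≤_) (ℕ.+-identityʳ l) n≤))
        (ℕ.<⇒≱ (ℕ.m<n⇒m<1+n ℕ.≤-refl))
      continue (suc fuel) n≤ = extend fuel (subst (n ≤_) (ℕ.+-suc l fuel) n≤)
        (cons-isPath (symmetric c~w) w∉φ path)
        (suc j) φj≡u (snoc ω c~w (λ w≡u → w∉φ j (trans φj≡u (sym w≡u))))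

  record Arc : Set where
    field
      {tail head} : Fin n
      edge        : Adj tail head

  open Arc

  -- Beyond the heads of such arcs lie pairwise disjoint parts of the tree, each
  -- of which has a leaf.
  divergingArcs⇒leaves : ∀ {k} (e : Fin k → Arc) →
    (∀ i j → i ≢ j → Walk (_≢ head (e i)) (tail (e i)) (head (e j))) →
    k ≤ leafCount
  divergingArcs⇒leaves e diverge =
    injective⇒≤∣p∣ _ (distinct⇒injective leaf-distinct)
      (λ i → T⇒∈ (does⁺ (degree _ ℕ.≟ 1) (proj₁ (proj₂ (beyond i)))))
    where
    beyond = λ i → leafBeyond (edge (e i))
    leaf = λ i → proj₁ (beyond i)
    reach : ∀ i → Walk (_≢ tail (e i)) (head (e i)) (leaf i)
    reach i = proj₂ (proj₂ (beyond i))
    leaf-distinct : ∀ i j → i ≢ j → leaf i ≢ leaf j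
    -- Suppose the leaves coincide. If the walk to leaf `j` avoids the head of arc `i`, then that
    -- leaf is reachable from both ends of arc `i`. If it meets that head, then that head is
    -- reachable from both ends of arc `j`.
    leaf-distinct i j i≢j eq with avoid-or-reach (head (e i)) (reach j)
    ... | inj₁ ω = edge-separates (edge (e i)) (diverge i j i≢j ++ ω)
      (subst (Walk _ _) eq (reach i))
    ... | inj₂ ω = edge-separates (edge (e j)) (diverge j i (i≢j ∘ sym)) ω

  -- Subtrees of the host tree along an edge.

  infix 4 _∈ˢ_ _∉ˢ_
  _∈ˢ_ _∉ˢ_ : Fin n → Subtree H → Set
  x ∈ˢ S = x ∈ Subtree.vertices S
  x ∉ˢ S = ¬ x ∈ˢ S

  _∈ˢ?_ : ∀ x S → Dec (x ∈ˢ S)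
  x ∈ˢ? S = x ∈? Subtree.vertices S

  walkIn : ∀ S → u ∈ˢ S → v ∈ˢ S → Walk (_∈ˢ S) u v
  walkIn {u} {v} S u∈S v∈S = go u∈S (Subtree.connected S u∈S v∈S)
    where
    go : ∀ {w} → w ∈ˢ S → Star (Subtree.Joined S) w v → Walk (_∈ˢ S) w v
    go w∈S ε       = stop w∈S
    go w∈S (j ◅ ω) with Subtree.subgraph S j
    ... | adj , _ , x∈S = move w∈S adj (go x∈S ω)

  ∈∉⇒≢ : ∀ S {x y} → x ∈ˢ S → y ∉ˢ S → x ≢ y
  ∈∉⇒≢ S x∈S y∉S refl = y∉S x∈S

  walkAvoiding : ∀ S {x} → x ∉ˢ S → u ∈ˢ S → v ∈ˢ S → Walk (_≢ x) u v
  walkAvoiding S x∉S u∈S v∈S = map (λ y∈S → ∈∉⇒≢ S y∈S x∉S) (walkIn S u∈S v∈S)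

  -- A common vertex would be reached from `u` inside `S`, avoiding `v`, and from `v` inside `T`,
  -- avoiding `u`.
  straddled⇒¬meet : ∀ S T → Adj u v → u ∈ˢ S → v ∉ˢ S → v ∈ˢ T → u ∉ˢ T →
                    ¬ (∃[ x ] x ∈ˢ S × x ∈ˢ T)
  straddled⇒¬meet S T u~v u∈S v∉S v∈T u∉T (x , x∈S , x∈T) =
    edge-separates u~v (walkAvoiding S v∉S u∈S x∈S) (walkAvoiding T u∉T v∈T x∈T)

  -- What an edge uv between the subtrees S₀ and T₀ of the last vertex sees of the
  -- other pairs (S i , T i): reaching T i from u goes through S₀, and reaching S i
  -- from v goes through T₀.  Exchanging S with T and u with v is a symmetry.
  record Linked {k} (S T : Fin k → Subtree H) (u v : Fin n) : Set where
    field
      adj      : Adj u v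
      meet     : ∀ i → ∃[ x ] x ∈ˢ S i × x ∈ˢ T i
      disjoint : ∀ {i j x} → i ≢ j → x ∈ˢ S i → x ∉ˢ T j
      reachT   : ∀ i → ∃[ y ] y ∈ˢ T i × Walk (_≢ v) u y
      reachS   : ∀ i → ∃[ y ] y ∈ˢ S i × Walk (_≢ u) v y

  swap : ∀ {k} {S T : Fin k → Subtree H} → Linked S T u v → Linked T S v u
  swap L = record
    { adj      = symmetric adj
    ; meet     = λ i → let x , x∈S , x∈T = meet i in x , x∈T , x∈S
    ; disjoint = λ i≢j x∈T x∈S → disjoint (i≢j ∘ sym) x∈S x∈T
    ; reachT   = reachS
    ; reachS   = reachT }
    where open Linked L

  module _ {k} {S T : Fin k → Subtree H} (L : Linked S T u v) where
    open Linked L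

    -- If `u` lay in neither, a walk from `v` through `S i` and on through `T i` would avoid `u` and
    -- end at a vertex that `u` reaches without using `v`.
    covers : ∀ i → u ∈ˢ S i ⊎ u ∈ˢ T i
    covers i with u ∈ˢ? S i | u ∈ˢ? T i
    ... | yes u∈S | _       = inj₁ u∈S
    ... | no _    | yes u∈T = inj₂ u∈T
    ... | no u∉S  | no u∉T
      with x , x∈S , x∈T ← meet i | s , s∈S , ω ← reachS i | t , t∈T , ω′ ← reachT i =
      ⊥-elim (edge-separates adj ω′
        (ω ++ walkAvoiding (S i) u∉S s∈S x∈S ++ walkAvoiding (T i) u∉T x∈T t∈T))

    leaves-if-inside-T : (∀ i → u ∉ˢ S i) → (∀ i → v ∉ˢ S i × v ∈ˢ T i) →
                         suc k ≤ leafCount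
    leaves-if-inside-T u∉S v∈T = divergingArcs⇒leaves arc diverge
      where
      enter : ∀ i → Crossing (_∈ˢ T i) (_∈ˢ S i) v
      enter i with x , x∈S , x∈T ← meet i =
        firstCrossing (_∈ˢ? S i) (walkIn (T i) (proj₂ (v∈T i)) x∈T) (proj₁ (v∈T i)) x∈S
      module Enter i = Crossing (enter i)
      arc : Fin (suc k) → Arc
      arc zero    = record { edge = symmetric adj }
      arc (suc i) = record { edge = Enter.crosses i }
      back : ∀ i → Walk (_∉ˢ S i) (Enter.before i) v
      back i = reverse (map proj₂ (Enter.approach i))
      diverge : ∀ i j → i ≢ j → Walk (_≢ head (arc i)) (tail (arc i)) (head (arc j))
      diverge zero    zero    0≢0 = contradiction refl 0≢0
      -- From `v` to `S j` avoiding `u`, then inside `S j`, which does not contain `u`.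
      diverge zero    (suc j) _   with y , y∈S , ω ← reachS j =
        ω ++ walkAvoiding (S j) (u∉S j) y∈S (Enter.after∈Q j)
      diverge (suc i) zero    _   =
        map (λ y∉S → ∈∉⇒≢ (S i) (Enter.after∈Q i) y∉S ∘ sym)
          (snoc (back i) (symmetric adj) (u∉S i))
      -- Back to `v` outside `S i`, then forward inside `T j`, which is disjoint from `S i`.
      diverge (suc i) (suc j) i≢j =
        map (λ y∉S → ∈∉⇒≢ (S i) (Enter.after∈Q i) y∉S ∘ sym)
          (back i ++ map (λ y∈T y∈S → disjoint (i≢j ∘ cong suc) y∈S y∈T)
            (snoc (map proj₁ (Enter.approach j)) (Enter.crosses j) (Enter.after∈P j)))

  module _ {k} {S T : Fin (2 + k) → Subtree H} (L : Linked S T u v) where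
    open Linked L

    -- By `covers`, `u` lies in `S zero` or in `T zero`; disjointness for distinct indices then
    -- forces the same side at every other index.
    one-sided : (∀ i → u ∉ˢ S i × u ∈ˢ T i) ⊎ (∀ i → u ∉ˢ T i × u ∈ˢ S i)
    one-sided = Sum.map
      (everywhere S T disjoint (covers L))
      (everywhere T S (λ i≢j x∈T x∈S → disjoint (i≢j ∘ sym) x∈S x∈T) (Sum.swap ∘ covers L))
      (Sum.swap (covers L zero))
      where
      everywhere : ∀ (S T : Fin (2 + k) → Subtree H) →
        (∀ {i j x} → i ≢ j → x ∈ˢ S i → x ∉ˢ T j) → (∀ i → u ∈ˢ S i ⊎ u ∈ˢ T i) →
        u ∈ˢ T zero → ∀ i → u ∉ˢ S i × u ∈ˢ T i
      everywhere S T disj cov u∈T = λ where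
          (suc i) → spread zero (suc i) (λ ()) u∈T
          -- Index `zero` is settled by going to index one and back, so at least two pairs are
          -- required.
          zero    → spread (suc zero) zero (λ ())
                      (proj₂ (spread zero (suc zero) (λ ()) u∈T))
        where
        spread : ∀ i j → i ≢ j → u ∈ˢ T i → u ∉ˢ S j × u ∈ˢ T j
        spread i j i≢j u∈T = u∉S , [ (λ u∈S → contradiction u∈S u∉S) , id ]′ (cov j)
          where
          u∉S : u ∉ˢ S j
          u∉S u∈S = disj (i≢j ∘ sym) u∈S u∈T

  linked⇒leaves : ∀ {k} {S T : Fin (2 + k) → Subtree H} → Linked S T u v → 3 + k ≤ leafCount
  -- `swap` exchanges the two sides, so unlike constructors mean that `u` and `v` are on the same
  -- side. Like constructors would make `S zero` and `T zero` straddle the edge.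
  linked⇒leaves {S = S} {T} L with one-sided L | one-sided (swap L)
  ... | inj₁ u∈T | inj₂ v∈T = leaves-if-inside-T L (proj₁ ∘ u∈T) v∈T
  ... | inj₂ u∈S | inj₁ v∈S = leaves-if-inside-T (swap L) (proj₁ ∘ v∈S) u∈S
  ... | inj₁ u∈T | inj₁ v∈S with u∉S , u∈T ← u∈T zero | v∉T , v∈S ← v∈S zero =
    contradiction (Linked.meet L zero)
      (straddled⇒¬meet (S zero) (T zero) (symmetric (Linked.adj L)) v∈S u∉S u∈T v∉T)
  ... | inj₂ u∈S | inj₂ v∈T with u∉T , u∈S ← u∈S zero | v∉S , v∈T ← v∈T zero =
    contradiction (Linked.meet L zero)
      (straddled⇒¬meet (S zero) (T zero) (Linked.adj L) u∈S v∉S v∈T u∉T)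

-- Entries of the adjacency matrix of `E n`.

Last : Fin n → Set
Last {n} i = suc (toℕ i) ≡ n

Last? : Decidable (Last {n})
Last? i = _ ℕ.≟ _

module _ {k : ℕ} where
  private
    last : Fin (suc k)
    last = fromℕ k

  Last-fromℕ : Last last
  Last-fromℕ = cong suc (Fin.toℕ-fromℕ k)

  ¬Last-inject₁ : ∀ (i : Fin k) → ¬ Last (inject₁ i)
  ¬Last-inject₁ i = Fin.toℕ-inject₁-≢ i ∘ sym ∘ ℕ.suc-injective

  isLast-last : isLast last ≡ true
  isLast-last = dec-true (Last? last) Last-fromℕ

  isLast-inject₁ : ∀ (i : Fin k) → isLast (inject₁ i) ≡ false
  isLast-inject₁ i = dec-false (Last? (inject₁ i)) (¬Last-inject₁ i)

  E-diagonal : ∀ {i j : Fin k} → Edge (E (suc k)) (inject₁ i) (inject₁ j) ⇔ i ≡ j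
  E-diagonal {i} {j} rewrite isLast-inject₁ i | isLast-inject₁ j = mk⇔
    (Fin.inject₁-injective ∘ does⁻ (inject₁ i Fin.≟ inject₁ j))
    (does⁺ (inject₁ i Fin.≟ inject₁ j) ∘ cong inject₁)

  E-column : ∀ (i : Fin k) → Edge (E (suc k)) (inject₁ i) last
  E-column i rewrite isLast-inject₁ i | isLast-last = tt

  E-row : ∀ (i : Fin k) → Edge (E (suc k)) last (inject₁ i)
  E-row i rewrite isLast-inject₁ i | isLast-last = tt

  E-corner : ¬ Edge (E (suc k)) last last
  E-corner rewrite isLast-last = id

-- Lower bound for the leafage of `E n`.

module _ {D : Digraph n} {H : Tree m} (R : SubtreeRepresentation D H) where
  open SubtreeRepresentation R
  open InTree H

  edge⇒meet : ∀ {u v} → Edge D u v → ∃[ x ] x ∈ˢ source u × x ∈ˢ target v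
  edge⇒meet {u} {v} uv with x , x∈ ← Equivalence.to (represents u v) uv =
    x , x∈p∩q⁻ _ _ x∈

  meet⇒edge : ∀ {u v x} → x ∈ˢ source u → x ∈ˢ target v → Edge D u v
  meet⇒edge x∈S x∈T = Equivalence.from (represents _ _) (_ , x∈p∩q⁺ (x∈S , x∈T))

leaves-E : ∀ {k} (H : Tree m) → SubtreeRepresentation (E (3 + k)) H →
           3 + k ≤ Tree.leafCount H
leaves-E {k = k} H R = linked⇒leaves {S = source ∘ inject₁} {T = target ∘ inject₁} record
  { adj      = crosses
  ; meet     = λ i → edge⇒meet R (Equivalence.from (E-diagonal {i = i}) refl)
  ; disjoint = λ i≢j x∈S x∈T → i≢j (Equivalence.to E-diagonal (meet⇒edge R x∈S x∈T))
  -- Back along the approach, which is outside `T₀`, to its start in `S₀`, then inside `S₀`. Both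
  -- parts miss `T₀`, hence avoid `v`.
  ; reachT   = λ i → let y , y∈S₀ , y∈T = edge⇒meet R (E-row i) in
      y , y∈T , map (λ x∉T₀ → ∈∉⇒≢ T₀ after∈Q x∉T₀ ∘ sym) (reverse (map proj₂ approach))
            ++ walkAvoiding S₀ (λ v∈S₀ → S₀∩T₀=∅ v∈S₀ after∈Q) a∈S₀ y∈S₀
  ; reachS   = λ i → let y , y∈S , y∈T₀ = edge⇒meet R (E-column i) in
      y , y∈S , walkAvoiding T₀ (proj₂ (end approach)) after∈Q y∈T₀
  }
  where
  open SubtreeRepresentation R
  open InTree H
  S₀ = source (fromℕ (2 + k))
  T₀ = target (fromℕ (2 + k))
  S₀∩T₀=∅ : ∀ {x} → x ∈ˢ S₀ → x ∉ˢ T₀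
  S₀∩T₀=∅ x∈S₀ x∈T₀ = E-corner {2 + k} (meet⇒edge R x∈S₀ x∈T₀)
  a∈S₀ = proj₂ (Subtree.nonempty S₀)
  b∈T₀ = proj₂ (Subtree.nonempty T₀)
  -- The zero corner makes `S₀` and `T₀` disjoint, so a walk between them has a first edge entering
  -- `T₀`; this is the edge `uv`.
  open Crossing (firstCrossing (_∈ˢ? T₀) (fromStar (Tree.connected H _ _)) (S₀∩T₀=∅ a∈S₀) b∈T₀)

-- The star and its subtrees.

∣tabulate∣-true : ∀ {f : Fin n → Bool} → (∀ i → f i ≡ true) → ∣ tabulate f ∣ ≡ n
∣tabulate∣-true {zero}  eq = refl
∣tabulate∣-true {suc n} eq rewrite eq zero = cong suc (∣tabulate∣-true (eq ∘ suc))

∣tabulate∣-false : ∀ {f : Fin n → Bool} → (∀ i → f i ≡ false) → ∣ tabulate f ∣ ≡ 0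
∣tabulate∣-false {zero}  eq = refl
∣tabulate∣-false {suc n} eq rewrite eq zero = ∣tabulate∣-false (eq ∘ suc)

spoke : Fin (suc n) → Fin (suc n) → Bool
spoke zero    (suc _) = true
spoke (suc _) zero    = true
spoke _       _       = false

spoke-sym : ∀ (u v : Fin (suc n)) → T (spoke u v) → T (spoke v u)
spoke-sym zero    (suc _) _ = tt
spoke-sym (suc _) zero    _ = tt

spoke-irrefl : ∀ (u v : Fin (suc n)) → u ≡ v → ¬ T (spoke u v)
spoke-irrefl zero    .zero    refl ()
spoke-irrefl (suc _) .(suc _) refl ()

spoke-centre : ∀ (u v : Fin (suc n)) → T (spoke u v) → u ≡ zero ⊎ v ≡ zero
spoke-centre zero    _    _ = inj₁ refl
spoke-centre (suc _) zero _ = inj₂ refl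

starGraph : ∀ n → Graph (suc n)
starGraph n = record
  { adjacent    = spoke
  ; symmetric   = λ {u} {v} → spoke-sym u v
  ; irreflexive = λ {u} {v} → spoke-irrefl u v }

starTree : ∀ n → Tree (suc n)
starTree n = record
  { graph     = starGraph n
  ; nonempty  = _
  ; connected = λ u v → toCentre u ◅◅ fromCentre v
  ; acyclic   = acyclic }
  where
  open Graph (starGraph n)
  toCentre : ∀ u → Star Adj u zero
  toCentre zero    = ε
  toCentre (suc u) = tt ◅ ε
  fromCentre : ∀ v → Star Adj zero v
  fromCentre zero    = ε
  fromCentre (suc v) = tt ◅ ε
  acyclic : Acyclic
  -- Every edge contains the centre. If the centre is vertex 0 of the cycle, the edge from vertex 1
  -- to vertex 2 misses it; if it is vertex 1, the closing edge does.
  acyclic k C = [ centre-at-0 , centre-at-1 ]′ (spoke-centre _ _ (step zero))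
    where
    open Cycle C
    once : ∀ {i j} → i ≢ j → vertex i ≡ zero → vertex j ≢ zero
    once i≢j vᵢ vⱼ = i≢j (injective (trans vᵢ (sym vⱼ)))
    centre-at-0 : vertex zero ≢ zero
    centre-at-0 v₀ = [ once (λ ()) v₀ , once (λ ()) v₀ ]′ (spoke-centre _ _ (step (suc zero)))
    centre-at-1 : vertex (suc zero) ≢ zero
    centre-at-1 v₁ = [ once (λ ()) v₁ , once (λ ()) v₁ ]′ (spoke-centre _ _ close)

starTree-leafCount : ∀ n → Tree.leafCount (starTree (2 + n)) ≡ 2 + n
starTree-leafCount n
  -- With at least two spokes the centre is not a leaf itself.
  rewrite dec-false (Tree.degree (starTree (2 + n)) zero ℕ.≟ 1)
    (λ eq → contradiction (trans (sym (∣tabulate∣-true {n = 2 + n} (λ _ → refl))) eq) λ ()) =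
  ∣tabulate∣-true {n = 2 + n} λ i →
    dec-true (_ ℕ.≟ 1) (cong suc (∣tabulate∣-false {n = 2 + n} (λ _ → refl)))

-- In a star, a set of vertices is connected once it is a single vertex or contains the centre.
inducedSubtree : ∀ (p : Subset (suc n)) → Nonempty p →
                 (∀ {u v} → u ∈ p → v ∈ p → u ≡ v ⊎ zero ∈ p) → Subtree (starTree n)
inducedSubtree p nonempty connects = record
  { vertices  = p
  ; joined    = λ u v → spoke u v ∧ does (u ∈? p) ∧ does (v ∈? p)
  ; symmetric = λ {u} {v} j → let a , u∈p , v∈p = joined⁻ j in joined⁺ (spoke-sym u v a) v∈p u∈p
  ; subgraph  = joined⁻
  ; nonempty  = nonempty
  ; connected = λ u∈p v∈p → connect u∈p v∈p (connects u∈p v∈p) }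
  where
  Joined : Fin _ → Fin _ → Set
  Joined u v = T (spoke u v ∧ does (u ∈? p) ∧ does (v ∈? p))
  joined⁻ : ∀ {u v} → Joined u v → T (spoke u v) × u ∈ p × v ∈ p
  joined⁻ {u} {v} j with a , b ← Equivalence.to T-∧ j with c , d ← Equivalence.to T-∧ b =
    a , does⁻ (u ∈? p) c , does⁻ (v ∈? p) d
  joined⁺ : ∀ {u v} → T (spoke u v) → u ∈ p → v ∈ p → Joined u v
  joined⁺ {u} {v} a u∈p v∈p = Equivalence.from T-∧
    (a , Equivalence.from T-∧ (does⁺ (u ∈? p) u∈p , does⁺ (v ∈? p) v∈p))
  connect : ∀ {u v} → u ∈ p → v ∈ p → u ≡ v ⊎ zero ∈ p → Star Joined u v
  connect u∈p v∈p (inj₁ refl) = ε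
  connect {u} {v} u∈p v∈p (inj₂ 0∈p) = toCentre u u∈p ◅◅ fromCentre v v∈p
    where
    toCentre : ∀ u → u ∈ p → Star Joined u zero
    toCentre zero    _   = ε
    toCentre (suc u) u∈p = joined⁺ tt u∈p 0∈p ◅ ε
    fromCentre : ∀ v → v ∈ p → Star Joined zero v
    fromCentre zero    _   = ε
    fromCentre (suc v) v∈p = joined⁺ tt 0∈p v∈p ◅ ε

-- The only possible common vertex is the leaf `suc u`; the centre serves to connect the targets.
-- This works for every digraph.
starRepresentation : (D : Digraph n) → SubtreeRepresentation D (starTree n)
starRepresentation {n} D = record
  { source     = λ u → inducedSubtree ⁅ suc u ⁆ (suc u , x∈⁅x⁆ (suc u))
      (λ x∈ y∈ → inj₁ (trans (x∈⁅y⁆⇒x≡y (suc u) x∈) (sym (x∈⁅y⁆⇒x≡y (suc u) y∈))))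
  ; target     = λ v → inducedSubtree (target v) (zero , here) (λ _ _ → inj₂ here)
  ; represents = λ u v → mk⇔
      (λ uv → suc u , x∈p∩q⁺ {q = target v} (x∈⁅x⁆ (suc u) , there (T⇒∈ {f = λ u → D u v} uv)))
      (λ (x , x∈) → let x∈S , x∈T = x∈p∩q⁻ ⁅ suc u ⁆ (target v) x∈ in
        ∈⇒T {f = λ u → D u v}
          (drop-there (subst (_∈ target v) (x∈⁅y⁆⇒x≡y (suc u) x∈S) x∈T))) }
  where
  target : Fin n → Subset (suc n)
  target v = inside ∷ tabulate (λ u → D u v)

-- Ferrers digraphs: complements, conflicts and a splitting.

ferrers-complement : ∀ {D : Digraph n} → Ferrers D → Ferrers (λ u v → not (D u v))
ferrers-complement {D = D} ferrers u v = Sum.map contra contra (ferrers v u)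
  where
  contra : ∀ {u v} → Edge D v ⊆ Edge D u → ∀ {x} → T (not (D u x)) → T (not (D v x))
  contra v⊆u {x} u∌x = T-not⁺ λ v∋x → T-not⁻ {D _ x} u∌x (v⊆u v∋x)

-- De Morgan, as complementation reverses the inclusions between successor sets. It yields `f ≤ f*`,
-- so one construction and one lower bound settle both numbers.
disjointUnion⇒intersection : ∀ {D : Digraph n} {k} →
  ComplementIsDisjointUnionOfFerrers D k → IsIntersectionOfFerrers D k
disjointUnion⇒intersection {D = D} (F , ferrers , _ , union⊆ , ⊆union) =
  (λ i u v → not (F i u v)) , (λ i → ferrers-complement (ferrers i)) ,
  (λ {x} notF → decidable-stable (T? (D (proj₁ x) (proj₂ x))) λ ¬D →
     let i , Fi = ⊆union ¬D in T-not⁻ {F i (proj₁ x) (proj₂ x)} (notF i) Fi) ,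
  (λ d i → T-not⁺ λ Fi → union⊆ (i , Fi) d)

-- (u , y) and (v , x) conflict if a Ferrers digraph containing D cannot omit both.
Conflict : Digraph n → Rel (Fin n × Fin n) 0ℓ
Conflict D (u , y) (v , x) = Edge D u x × Edge D v y

-- Each `z i` is omitted by some `F a`, and nested successor sets prevent one `F a` from omitting
-- two conflicting pairs; the choice of `a` is therefore injective.
conflicts⇒≤ : ∀ {D : Digraph n} {c k} (z : Fin c → Fin n × Fin n) →
              (∀ i → ¬ EdgeSet D (z i)) → (∀ i j → i ≢ j → Conflict D (z i) (z j)) →
              IsIntersectionOfFerrers D k → c ≤ k
conflicts⇒≤ {D = D} {k = k} z z∉D conflict (F , ferrers , ⋂⊆ , ⊆⋂) =
  Fin.injective⇒≤ (distinct⇒injective omitter-distinct)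
  where
  omitted : ∀ i → ∃[ a ] ¬ EdgeSet (F a) (z i)
  omitted i = Fin.¬∀⟶∃¬ k _ (λ a → T? _) (z∉D i ∘ ⋂⊆)
  omitter = λ i → proj₁ (omitted i)
  clash : ∀ {i j} a → Conflict D (z i) (z j) →
          ¬ EdgeSet (F a) (z i) → ¬ EdgeSet (F a) (z j) → ⊥
  clash a (ux , vy) ∌z ∌z′ =
    [ (λ u⊆v → ∌z′ (u⊆v (⊆⋂ ux a))) , (λ v⊆u → ∌z (v⊆u (⊆⋂ vy a))) ]′ (ferrers a _ _)
  omitter-distinct : ∀ i j → i ≢ j → omitter i ≢ omitter j
  omitter-distinct i j i≢j eq = clash (omitter j) (conflict i j i≢j)
    (subst (λ a → ¬ EdgeSet (F a) (z i)) eq (proj₂ (omitted i))) (proj₂ (omitted j))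

-- In the triangles only the larger index is tested for being last; the smaller one then cannot be
-- last either.
Part : Fin 3 → Rel (Fin n) 0ℓ
Part zero             i j = ¬ Last j × toℕ i < toℕ j
Part (suc zero)       i j = ¬ Last i × toℕ j < toℕ i
Part (suc (suc zero)) i j = Last i × Last j

Part? : ∀ c (i j : Fin n) → Dec (Part c i j)
Part? zero             i j = ¬? (Last? j) ×-dec (toℕ i ℕ.<? toℕ j)
Part? (suc zero)       i j = ¬? (Last? i) ×-dec (toℕ j ℕ.<? toℕ i)
Part? (suc (suc zero)) i j = Last? i ×-dec Last? j

-- Successor sets shrink down the rows of the upper triangle and grow down those of the lower one,
-- except that its last row is empty. For the corner only the last row is nonempty.
Part-total : ∀ c → Total (λ (i j : Fin n) → Part c i ⊆ Part c j)
Part-total zero i j with ℕ.≤-total (toℕ i) (toℕ j)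
... | inj₁ i≤j = inj₂ λ (¬l , j<x) → ¬l , ℕ.≤-<-trans i≤j j<x
... | inj₂ j≤i = inj₁ λ (¬l , i<x) → ¬l , ℕ.≤-<-trans j≤i i<x
Part-total (suc zero) i j with Last? i | Last? j | ℕ.≤-total (toℕ i) (toℕ j)
... | yes l | _      | _        = inj₁ λ (¬l , _) → contradiction l ¬l
... | no _  | yes l  | _        = inj₂ λ (¬l , _) → contradiction l ¬l
... | no _  | no ¬l  | inj₁ i≤j = inj₁ λ (_ , x<i) → ¬l , ℕ.<-≤-trans x<i i≤j
... | no ¬l | no _   | inj₂ j≤i = inj₂ λ (_ , x<j) → ¬l , ℕ.<-≤-trans x<j j≤i
Part-total (suc (suc zero)) i j with Last? i
... | yes l = inj₂ λ (_ , lx) → l , lx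
... | no ¬l = inj₁ λ (l , _) → contradiction l ¬l

Part-unique : ∀ c d {i j : Fin n} → Part c i j → Part d i j → c ≡ d
Part-unique zero             zero             _          _          = refl
Part-unique zero             (suc zero)       (_ , i<j)  (_ , j<i)  = contradiction i<j (ℕ.<-asym j<i)
Part-unique zero             (suc (suc zero)) (¬l , _)   (_ , l)    = contradiction l ¬l
Part-unique (suc zero)       zero             (_ , j<i)  (_ , i<j)  = contradiction i<j (ℕ.<-asym j<i)
Part-unique (suc zero)       (suc zero)       _          _          = refl
Part-unique (suc zero)       (suc (suc zero)) (¬l , _)   (l , _)    = contradiction l ¬l
Part-unique (suc (suc zero)) zero             (_ , l)    (¬l , _)   = contradiction l ¬l
Part-unique (suc (suc zero)) (suc zero)       (l , _)    (¬l , _)   = contradiction l ¬l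
Part-unique (suc (suc zero)) (suc (suc zero)) _          _          = refl

nonEdge⇒Part : ∀ {k} (i j : Fin (suc k)) → ¬ Edge (E (suc k)) i j → ∃[ c ] Part c i j
nonEdge⇒Part i j ¬e with view i | view j
... | ‵fromℕ     | ‵fromℕ     = suc (suc zero) , Last-fromℕ , Last-fromℕ
... | ‵fromℕ     | ‵inject₁ j = contradiction (E-row j) ¬e
... | ‵inject₁ i | ‵fromℕ     = contradiction (E-column i) ¬e
... | ‵inject₁ i | ‵inject₁ j with ℕ.<-cmp (toℕ (inject₁ i)) (toℕ (inject₁ j))
...   | tri< i<j _ _ = zero , ¬Last-inject₁ j , i<j
...   | tri> _ _ j<i = suc zero , ¬Last-inject₁ i , j<i
...   | tri≈ _ i≡j _ = contradiction
  (Equivalence.from E-diagonal (Fin.inject₁-injective (Fin.toℕ-injective i≡j))) ¬e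

Part⇒nonEdge : ∀ {k} (i j : Fin (suc k)) c → Part c i j → ¬ Edge (E (suc k)) i j
Part⇒nonEdge {k} i j c p with view i | view j
... | ‵fromℕ     | ‵fromℕ     = E-corner {k}
... | ‵fromℕ     | ‵inject₁ j = contradiction p (off-row c)
  where
  off-row : ∀ c → ¬ Part c (fromℕ k) (inject₁ j)
  off-row zero             (_ , l<j) = ℕ.<⇒≱ l<j (Fin.≤fromℕ (inject₁ j))
  off-row (suc zero)       (¬l , _)  = ¬l Last-fromℕ
  off-row (suc (suc zero)) (_ , l)   = ¬Last-inject₁ j l
... | ‵inject₁ i | ‵fromℕ     = contradiction p (off-column c)
  where
  off-column : ∀ c → ¬ Part c (inject₁ i) (fromℕ k)
  off-column zero             (¬l , _)  = ¬l Last-fromℕ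
  off-column (suc zero)       (_ , l<i) = ℕ.<⇒≱ l<i (Fin.≤fromℕ (inject₁ i))
  off-column (suc (suc zero)) (l , _)   = ¬Last-inject₁ i l
... | ‵inject₁ i | ‵inject₁ j = λ e → off-diagonal c p (Equivalence.to E-diagonal e)
  where
  off-diagonal : ∀ c → Part c (inject₁ i) (inject₁ j) → i ≢ j
  off-diagonal zero             (_ , i<j) refl = ℕ.<-irrefl refl i<j
  off-diagonal (suc zero)       (_ , j<i) refl = ℕ.<-irrefl refl j<i
  off-diagonal (suc (suc zero)) (l , _)   _    = ¬Last-inject₁ i l

E-disjointUnion : ∀ k → ComplementIsDisjointUnionOfFerrers (E (suc k)) 3
E-disjointUnion k = F , ferrers , disjoint ,
  (λ (c , f) → Part⇒nonEdge _ _ c (does⁻ (Part? c _ _) f)) ,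
  (λ {(i , j)} ¬e → let c , p = nonEdge⇒Part i j ¬e in c , does⁺ (Part? c i j) p)
  where
  F : Fin 3 → Digraph (suc k)
  F c i j = does (Part? c i j)
  ferrers : ∀ c → Ferrers (F c)
  ferrers c i j = Sum.map lift lift (Part-total c i j)
    where
    lift : ∀ {i j} → Part c i ⊆ Part c j → Edge (F c) i ⊆ Edge (F c) j
    lift i⊆j = does⁺ (Part? c _ _) ∘ i⊆j ∘ does⁻ (Part? c _ _)
  disjoint : ∀ c d → c ≢ d → EdgeSet (F c) ⊥ᵖ EdgeSet (F d)
  disjoint c d c≢d (f , g) =
    c≢d (Part-unique c d (does⁻ (Part? c _ _) f) (does⁻ (Part? d _ _) g))

-- Three pairwise conflicting zeros.

E-intersection⇒3≤ : ∀ {k j} → IsIntersectionOfFerrers (E (3 + k)) j → 3 ≤ j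
E-intersection⇒3≤ {k} = conflicts⇒≤ z z∉E conflict
  where
  a b last : Fin (3 + k)
  a    = zero
  b    = suc zero
  last = fromℕ (2 + k)
  z : Fin 3 → Fin (3 + k) × Fin (3 + k)
  z zero             = a , b
  z (suc zero)       = b , a
  z (suc (suc zero)) = last , last
  z∉E : ∀ i → ¬ EdgeSet (E (3 + k)) (z i)
  z∉E zero             = λ ()
  z∉E (suc zero)       = λ ()
  z∉E (suc (suc zero)) = E-corner {2 + k}
  col = λ i → E-column {2 + k} i
  row = λ i → E-row {2 + k} i
  conflict : ∀ i j → i ≢ j → Conflict (E (3 + k)) (z i) (z j)
  -- Diagonal ones complete the square of the first two zeros; ones of the last row and column
  -- complete those with the corner.
  conflict zero             (suc zero)       _ = tt , tt
  conflict (suc zero)       zero             _ = tt , tt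
  conflict zero             (suc (suc zero)) _ = col zero , row (suc zero)
  conflict (suc zero)       (suc (suc zero)) _ = col (suc zero) , row zero
  conflict (suc (suc zero)) zero             _ = row (suc zero) , col zero
  conflict (suc (suc zero)) (suc zero)       _ = row zero , col (suc zero)
  conflict zero             zero             i≢i = contradiction refl i≢i
  conflict (suc zero)       (suc zero)       i≢i = contradiction refl i≢i
  conflict (suc (suc zero)) (suc (suc zero)) i≢i = contradiction refl i≢i

-- The parameters of `E n` and the unboundedness of leafage.

E-leafage : ∀ k → IsLeafage (E (3 + k)) (3 + k)
E-leafage k =
  (4 + k , starTree (3 + k) , starRepresentation (E (3 + k)) , starTree-leafCount (suc k)) ,
  λ { _ (_ , H , R , refl) → leaves-E H R }

E-disjointFerrersNumber : ∀ k → IsDisjointFerrersNumber (E (3 + k)) 3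
E-disjointFerrersNumber k =
  E-disjointUnion (2 + k) , λ _ → E-intersection⇒3≤ {k} ∘ disjointUnion⇒intersection

E-ferrersDimension : ∀ k → IsFerrersDimension (E (3 + k)) 3
E-ferrersDimension k =
  disjointUnion⇒intersection (E-disjointUnion (2 + k)) , λ _ → E-intersection⇒3≤ {k}

theorem4 :
    (¬ (Σ[ g ∈ (ℕ → ℕ) ] (∀ n → .{{_ : NonZero n}} → (D : Digraph n) (l f* : ℕ) →
                        IsLeafage D l → IsDisjointFerrersNumber D f* → 3 ≤ f* →
                        l ≤ g f*)))
    × (∀ n → 3 ≤ n →
        IsLeafage (E n) n
        × IsDisjointFerrersNumber (E n) 3
        × IsFerrersDimension (E n) 3)
theorem4 =
  -- For `n = 3 + g 3` the leafage is `3 + g 3` while `f*` is 3, so the bound would give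
  -- `3 + g 3 ≤ g 3`.
  (λ (g , bound) → ℕ.m+1+n≰m _ (subst (_≤ g 3) (ℕ.+-comm 3 (g 3))
    (bound (3 + g 3) (E (3 + g 3)) (3 + g 3) 3
      (E-leafage (g 3)) (E-disjointFerrersNumber (g 3)) ℕ.≤-refl))) ,
  λ { _ (s≤s (s≤s (s≤s (z≤n {k})))) →
    E-leafage k , E-disjointFerrersNumber k , E-ferrersDimension k }
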